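{- Let $t=(t_n)_{n\ge 0}$ be a sequence with $t_n\neq 0$ for all $n$, and let $T=(T_n)_{n\ge0}$ with $T_n=t_{n+1}$. For a sequence $s=(s_n)$ let $p_n(x,s)$ denote the polynomials defined by $p_{ -1}(x,s)=0$, $p_0(x,s)=1$, $p_n(x,s)=x\,p_{n-1}(x,s)-s_{n-2}\,p_{n-2}(x,s)$ for $n\ge1$. Let $\Lambda$ be the linear functional on polynomials with $\Lambda(p_n(x,t))=[n=0]$ for all $n\ge0$, let $a(n)=\Lambda(x^{2n})$, $r(n,x)=\sum_{k=0}^n a(n-k)x^k$ and $d(n,x)=\det\big(r(i+j,x)\big)_{i,j=0}^n$. Then for all $n\ge 0$, $$\frac{d(n,x^2)}{d(n,0)}=\frac{(-1)^n}{t_1t_3\cdots t_{2n-1}}\,p_{2n}(x,T).$$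
   Context: $[n=0]$ denotes $1$ if $n=0$ and $0$ otherwise. $d(n,0)=\det(a(i+j))_{i,j=0}^n$, which is nonzero in this setting. For $n=0$ the empty product $t_1\cdots t_{2n-1}$ equals $1$. -}

module Defs where

open import Level using (Level; _⊔_)
open import Data.Nat using (ℕ; zero; suc) renaming (_+_ to _+ℕ_; _*_ to _*ℕ_; _∸_ to _∸ℕ_)
open import Data.Fin using (Fin; toℕ; punchIn) renaming (zero to fzero; suc to fsuc)
open import Data.List using (List; []; _∷_)
open import Data.Product using (Σ; _×_)
open import Relation.Nullary using (¬_)
open import Algebra.Bundles using (CommutativeRing)

record IsField {c ℓ : Level} (R : CommutativeRing c ℓ) : Set (c ⊔ ℓ) where
  open CommutativeRing R
  field
    0≉1     : ¬ (0# ≈ 1#)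
    inverse : (x : Carrier) → ¬ (x ≈ 0#) → Σ Carrier (λ y → x * y ≈ 1#)

module Poly {c ℓ : Level} (R : CommutativeRing c ℓ) where
  open CommutativeRing R renaming (_+_ to _⊕_; _*_ to _⊗_)

  -- Polynomials as coefficient lists, lowest degree first.
  Pol : Set c
  Pol = List Carrier

  addP : Pol → Pol → Pol
  addP [] q = q
  addP p [] = p
  addP (a ∷ p) (b ∷ q) = (a ⊕ b) ∷ addP p q

  scaleP : Carrier → Pol → Pol
  scaleP c [] = []
  scaleP c (a ∷ p) = (c ⊗ a) ∷ scaleP c p

  shiftP : Pol → Pol
  shiftP p = 0# ∷ p

  evalP : Pol → Carrier → Carrier
  evalP [] x = 0#
  evalP (a ∷ p) x = a ⊕ (x ⊗ evalP p x)

  -- p n s = p_n(x,s):  p_{-1}=0, p_0=1, p_n = x p_{n-1} - s_{n-2} p_{n-2}.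
  -- (so p_1 = x, and p_{n+2} = x p_{n+1} - s_n p_n)
  p : (ℕ → Carrier) → ℕ → Pol
  p s zero = 1# ∷ []
  p s (suc zero) = 0# ∷ 1# ∷ []
  p s (suc (suc n)) = addP (shiftP (p s (suc n))) (scaleP (- (s n)) (p s n))

  -- The linear functional with moments μ k = Λ(x^k), applied to a polynomial.
  Λ : (ℕ → Carrier) → Pol → Carrier
  Λ μ [] = 0#
  Λ μ (a ∷ q) = (a ⊗ μ 0) ⊕ Λ (λ k → μ (suc k)) q

  δ : ℕ → Carrier
  δ zero = 1#
  δ (suc _) = 0#

  pow : Carrier → ℕ → Carrier
  pow x zero = 1#
  pow x (suc n) = x ⊗ pow x n

  sumTo : ℕ → (ℕ → Carrier) → Carrier
  sumTo zero f = f 0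
  sumTo (suc n) f = sumTo n f ⊕ f (suc n)

  sumFin : (n : ℕ) → (Fin n → Carrier) → Carrier
  sumFin zero f = 0#
  sumFin (suc n) f = f fzero ⊕ sumFin n (λ j → f (fsuc j))

  det : (n : ℕ) → (Fin n → Fin n → Carrier) → Carrier
  det zero M = 1#
  det (suc n) M =
    sumFin (suc n) (λ j → pow (- 1#) (toℕ j) ⊗ (M fzero j ⊗
      det n (λ i k → M (fsuc i) (punchIn j k))))

  a : (ℕ → Carrier) → ℕ → Carrier
  a μ n = μ (2 *ℕ n)

  r : (ℕ → Carrier) → ℕ → Carrier → Carrier
  r μ n x = sumTo n (λ k → a μ (n ∸ℕ k) ⊗ pow x k)

  d : (ℕ → Carrier) → ℕ → Carrier → Carrier
  d μ n x = det (suc n) (λ i j → r μ (toℕ i +ℕ toℕ j) x)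

  oddProd : (ℕ → Carrier) → ℕ → Carrier
  oddProd t zero = 1#
  oddProd t (suc n) = oddProd t n ⊗ t (suc (2 *ℕ n))

-- Since r (m + 1, x) = x r (m, x) + a (m + 1), subtracting x times each row from the next one leaves
-- d (n, x) as the determinant with first row r (j, x) and rows a (i + j), i ≥ 1.
-- Write p_{2n+1} (y, t) = y Q (y ^ 2) with Q monic of degree n, and replace the last column by the
-- combination of all columns with the coefficients of Q, which does not change the determinant.
-- For d (n, x ^ 2) the new last column is (p_{2n} (x, T), 0, …, 0): the zeros by orthogonality, and
-- the first entry because p_{2n} (x, T) = Λ_y ((P (y) - P (x)) / (y - x)) for P = p_{2n+1} (·, t).
-- Hence d (n, x ^ 2) = (-1) ^ n p_{2n} (x, T) D_n with D_n = det (a (i + j + 1))_{i,j<n}, and x = 0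
-- gives d (n, 0) = t₁ t₃ ⋯ t_{2n-1} D_n.  The same column operation shows
-- D_{n+1} = t₀ t₁ ⋯ t_{2n} D_n, so D_n ≠ 0.
module Submission where

open import Defs
open import Level using (Level)
open import Data.Nat using (ℕ; suc)
import Data.Nat
open import Data.Product using (_×_)
open import Relation.Nullary using (¬_)
open import Algebra.Bundles using (CommutativeRing)

open import Data.List using ([]; _∷_)
open import Data.Nat using (zero; _<_; z≤n; s≤s) renaming (_+_ to _+ℕ_; _*_ to _*ℕ_; _∸_ to _∸ℕ_)
open import Data.Nat.Properties using (+-suc; m<n⇒m<1+n; n<1+n)
  renaming (+-identityʳ to +-identityʳ-ℕ; suc-injective to ℕ-suc-injective)
open import Data.Fin using (Fin; toℕ; fromℕ; fromℕ<; inject₁; punchIn) renaming (zero to fzero; suc to fsuc)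
open import Data.Fin.Properties using (toℕ-fromℕ; toℕ-fromℕ<; toℕ-inject₁; toℕ<n; inject₁ℕ<; fromℕ≢inject₁; suc-injective)
open import Data.Vec.Functional using (Vector; tail; updateAt) renaming (_∷_ to infixr 5 _◂_)
open import Data.Vec.Functional.Properties using (updateAt-updates; updateAt-minimal; updateAt-id-local)
open import Data.Product using (_,_)
open import Function using (_∘_)
open import Relation.Binary.PropositionalEquality as ≡ using (_≡_; _≢_)
open import Relation.Nullary using (contradiction)
import Algebra.Properties.CommutativeSemigroup
import Algebra.Properties.Ring
import Algebra.Properties.Semiring.Sum
import Algebra.Solver.Ring.NaturalCoefficients.Default
import Relation.Binary.Reasoning.Setoid

-- Index identities for deleting a column next to the last one

punchIn-inject₁-fromℕ : ∀ {n} (j : Fin (suc n)) → punchIn (inject₁ j) (fromℕ n) ≡ fromℕ (suc n)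
punchIn-inject₁-fromℕ fzero = ≡.refl
punchIn-inject₁-fromℕ {suc n} (fsuc j) = ≡.cong fsuc (punchIn-inject₁-fromℕ j)

punchIn-fromℕ : ∀ {n} (k : Fin n) → punchIn (fromℕ n) k ≡ inject₁ k
punchIn-fromℕ fzero = ≡.refl
punchIn-fromℕ (fsuc k) = ≡.cong fsuc (punchIn-fromℕ k)

punchIn-inject₁ : ∀ {n} (j : Fin (suc n)) (k : Fin n) → punchIn (inject₁ j) (inject₁ k) ≡ inject₁ (punchIn j k)
punchIn-inject₁ fzero k = ≡.refl
punchIn-inject₁ (fsuc j) fzero = ≡.refl
punchIn-inject₁ (fsuc j) (fsuc k) = ≡.cong fsuc (punchIn-inject₁ j k)

-- Determinants over a commutative ring

module Determinant {c ℓ : Level} (R : CommutativeRing c ℓ) where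
  open CommutativeRing R
  open Poly R
  open Algebra.Properties.Ring ring
  open Algebra.Properties.Semiring.Sum semiring
  open Algebra.Solver.Ring.NaturalCoefficients.Default commutativeSemiring
  open Relation.Binary.Reasoning.Setoid setoid

  Matrix : ℕ → ℕ → Set c
  Matrix m n = Fin m → Fin n → Carrier

  infix 4 _≋_
  _≋_ : ∀ {m n} → Matrix m n → Matrix m n → Set ℓ
  M ≋ N = ∀ i j → M i j ≈ N i j

  infix 30 _ᵀ
  _ᵀ : ∀ {m n} → Matrix m n → Matrix n m
  (M ᵀ) j i = M i j

  minor : ∀ {m n} → Fin (suc m) → Fin (suc n) → Matrix (suc m) (suc n) → Matrix m n
  minor i j M k l = M (punchIn i k) (punchIn j l)

  sign : ∀ {n} → Fin n → Carrier
  sign i = pow (- 1#) (toℕ i)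

  sumFin≡sum : ∀ n (f : Vector Carrier n) → sumFin n f ≡ sum f
  sumFin≡sum zero f = ≡.refl
  sumFin≡sum (suc n) f = ≡.cong (f fzero +_) (sumFin≡sum n (tail f))

  det-row : ∀ {n} (M : Matrix (suc n) (suc n)) →
            det (suc n) M ≈ sum (λ j → sign j * (M fzero j * det n (minor fzero j M)))
  det-row {n} M = reflexive (sumFin≡sum (suc n) (λ j → sign j * (M fzero j * det n (minor fzero j M))))

  sum-zero : ∀ {n} {f : Vector Carrier n} → (∀ i → f i ≈ 0#) → sum f ≈ 0#
  sum-zero {n} eq = trans (sum-cong-≋ eq) (sum-replicate-zero n)

  x*0*y≈0 : ∀ x {y} z → y ≈ 0# → x * (y * z) ≈ 0#
  x*0*y≈0 x z y≈0 = trans (*-congˡ (trans (*-congʳ y≈0) (zeroˡ z))) (zeroʳ x)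

  x*y*0≈0 : ∀ x y {z} → z ≈ 0# → x * (y * z) ≈ 0#
  x*y*0≈0 x y z≈0 = trans (*-congˡ (trans (*-congˡ z≈0) (zeroʳ y))) (zeroʳ x)

  det-cong : ∀ {n} {M N : Matrix n n} → M ≋ N → det n M ≈ det n N
  det-cong {zero} eq = refl
  det-cong {suc n} {M} {N} eq = begin
    det (suc n) M ≈⟨ det-row M ⟩
    _ ≈⟨ sum-cong-≋ (λ j → *-congˡ {sign j} (*-cong (eq fzero j) (det-cong (λ i k → eq (fsuc i) (punchIn j k))))) ⟩
    _ ≈⟨ det-row N ⟨
    det (suc n) N ∎

  -- Expanding every minor of the first row along its first column, and every minor of the first
  -- column along its first row, yields the same double sum.
  det-col : ∀ {n} (M : Matrix (suc n) (suc n)) →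
            det (suc n) M ≈ sum (λ i → sign i * (M i fzero * det n (minor i fzero M)))
  det-col {zero} M = refl
  det-col {suc n} M = trans (det-row M) (+-congˡ (begin
      sum (λ j → sign (fsuc j) * (row j * det (suc n) (minor fzero (fsuc j) M)))
        ≈⟨ sum-cong-≋ (λ j → trans (*-congˡ {sign (fsuc j)} (*-congˡ {row j} (det-col (minor fzero (fsuc j) M))))
                                   (distrib² {suc n} (sign (fsuc j)) (row j) (λ i → sign i * (col i * D i j)))) ⟩
      sum (λ j → sum (λ i → sign (fsuc j) * (row j * (sign i * (col i * D i j)))))
        ≈⟨ ∑-comm {suc n} {suc n} (λ j i → sign (fsuc j) * (row j * (sign i * (col i * D i j)))) ⟩
      sum (λ i → sum (λ j → sign (fsuc j) * (row j * (sign i * (col i * D i j)))))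
        ≈⟨ sum-cong-≋ (λ i → sum-cong-≋ (λ j → exchange (- 1#) (sign j) (row j) (sign i) (col i) (D i j))) ⟩
      sum (λ i → sum (λ j → sign (fsuc i) * (col i * (sign j * (row j * D i j)))))
        ≈⟨ sum-cong-≋ (λ i → trans (*-congˡ {sign (fsuc i)} (*-congˡ {col i} (det-row (minor (fsuc i) fzero M))))
                                   (distrib² {suc n} (sign (fsuc i)) (col i) (λ j → sign j * (row j * D i j)))) ⟨
      sum (λ i → sign (fsuc i) * (col i * det (suc n) (minor (fsuc i) fzero M))) ∎))
    where
    row col : Fin (suc n) → Carrier
    row j = M fzero (fsuc j)
    col i = M (fsuc i) fzero
    D : Fin (suc n) → Fin (suc n) → Carrier
    D i j = det n (λ k l → M (fsuc (punchIn i k)) (fsuc (punchIn j l)))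
    distrib² : ∀ {m} x y (f : Vector Carrier m) → x * (y * sum f) ≈ sum (λ i → x * (y * f i))
    distrib² x y f = trans (*-congˡ (*-distribˡ-sum y f)) (*-distribˡ-sum x (λ i → y * f i))
    exchange : ∀ e u v w x y → (e * u) * (v * (w * (x * y))) ≈ (e * w) * (x * (u * (v * y)))
    exchange = solve 6 (λ e u v w x y → (e :* u) :* (v :* (w :* (x :* y))) := (e :* w) :* (x :* (u :* (v :* y)))) refl

  det-transpose : ∀ {n} (M : Matrix n n) → det n M ≈ det n (M ᵀ)
  det-transpose {zero} M = refl
  det-transpose {suc n} M = begin
    det (suc n) M ≈⟨ det-col M ⟩
    _ ≈⟨ sum-cong-≋ (λ i → *-congˡ {sign i} (*-congˡ {M i fzero} (det-transpose (minor i fzero M)))) ⟩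
    _ ≈⟨ det-row (M ᵀ) ⟨
    det (suc n) (M ᵀ) ∎

  -- One statement covers homogeneity and additivity. For row 0 the minors of the three matrices
  -- coincide; for a later row the linearity passes into each minor by induction.
  det-linear : ∀ {n} (k : Fin n) {A B C : Matrix n n} q →
               (∀ j → A k j ≈ q * B k j + C k j) →
               (∀ i → i ≢ k → ∀ j → A i j ≈ B i j) →
               (∀ i → i ≢ k → ∀ j → A i j ≈ C i j) →
               det n A ≈ q * det n B + det n C
  det-linear {suc n} k {A} {B} {C} q eq A≈B A≈C = begin
    det (suc n) A ≈⟨ det-row A ⟩
    sum (λ j → sign j * (A fzero j * det n (minor fzero j A)))
      ≈⟨ sum-cong-≋ (term k eq A≈B A≈C) ⟩
    sum (λ j → q * b j + c′ j) ≈⟨ ∑-distrib-+ {suc n} (λ j → q * b j) c′ ⟩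
    sum (λ j → q * b j) + sum c′ ≈⟨ +-congʳ (*-distribˡ-sum {suc n} q b) ⟨
    q * sum b + sum c′ ≈⟨ +-cong (*-congˡ (det-row B)) (det-row C) ⟨
    q * det (suc n) B + det (suc n) C ∎
    where
    b c′ : Fin (suc n) → Carrier
    b j = sign j * (B fzero j * det n (minor fzero j B))
    c′ j = sign j * (C fzero j * det n (minor fzero j C))
    term : ∀ k → (∀ j → A k j ≈ q * B k j + C k j) →
           (∀ i → i ≢ k → ∀ j → A i j ≈ B i j) →
           (∀ i → i ≢ k → ∀ j → A i j ≈ C i j) →
           ∀ j → sign j * (A fzero j * det n (minor fzero j A)) ≈ q * b j + c′ j
    term fzero eq A≈B A≈C j = begin
      sign j * (A fzero j * DA) ≈⟨ *-congˡ (*-congʳ (eq j)) ⟩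
      sign j * ((q * B fzero j + C fzero j) * DA)
        ≈⟨ solve 5 (λ e q x y d → e :* ((q :* x :+ y) :* d) := q :* (e :* (x :* d)) :+ e :* (y :* d)) refl
             (sign j) q (B fzero j) (C fzero j) DA ⟩
      q * (sign j * (B fzero j * DA)) + sign j * (C fzero j * DA)
        ≈⟨ +-cong (*-congˡ (*-congˡ (*-congˡ (det-cong (λ i l → A≈B (fsuc i) (λ ()) (punchIn j l))))))
                  (*-congˡ (*-congˡ (det-cong (λ i l → A≈C (fsuc i) (λ ()) (punchIn j l))))) ⟩
      q * b j + c′ j ∎
      where DA = det n (minor fzero j A)
    term (fsuc k) eq A≈B A≈C j = begin
      sign j * (A fzero j * det n (minor fzero j A))
        ≈⟨ *-congˡ (*-congˡ (det-linear k q (λ l → eq (punchIn j l))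
             (λ i i≢k l → A≈B (fsuc i) (i≢k ∘ suc-injective) (punchIn j l))
             (λ i i≢k l → A≈C (fsuc i) (i≢k ∘ suc-injective) (punchIn j l)))) ⟩
      sign j * (A fzero j * (q * DB + DC))
        ≈⟨ solve 5 (λ e a q x y → e :* (a :* (q :* x :+ y)) := q :* (e :* (a :* x)) :+ e :* (a :* y)) refl
             (sign j) (A fzero j) q DB DC ⟩
      q * (sign j * (A fzero j * DB)) + sign j * (A fzero j * DC)
        ≈⟨ +-cong (*-congˡ (*-congˡ (*-congʳ (A≈B fzero (λ ()) j))))
                  (*-congˡ (*-congʳ (A≈C fzero (λ ()) j))) ⟩
      q * b j + c′ j ∎
      where
      DB = det n (minor fzero j B)
      DC = det n (minor fzero j C)

  -- A zero row equals `- 1#` times itself plus itself, so linearity gives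
  -- `det M = - det M + det M`.
  det-zero-row : ∀ {n} (k : Fin n) (M : Matrix n n) → (∀ j → M k j ≈ 0#) → det n M ≈ 0#
  det-zero-row {n} k M eq = begin
    det n M ≈⟨ det-linear k {M} {M} {M} (- 1#) row (λ _ _ _ → refl) (λ _ _ _ → refl) ⟩
    - 1# * det n M + det n M ≈⟨ +-congʳ (-1*x≈-x _) ⟩
    - det n M + det n M ≈⟨ -‿inverseˡ _ ⟩
    0# ∎
    where
    row : ∀ j → M k j ≈ - 1# * M k j + M k j
    row j = trans (eq j) (sym (trans (+-congʳ (-1*x≈-x _)) (-‿inverseˡ _)))

  -- In the expansion along the first column the first two terms cancel, since their minors agree.
  -- Every later minor still starts with the two equal rows and vanishes by induction.
  det-alt₀₁ : ∀ {n} (M : Matrix (suc (suc n)) (suc (suc n))) →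
              (∀ j → M fzero j ≈ M (fsuc fzero) j) → det (suc (suc n)) M ≈ 0#
  det-alt₀₁ {n} M eq = begin
    det (suc (suc n)) M ≈⟨ det-col M ⟩
    1# * (M fzero fzero * D₀) + ((- 1# * 1#) * (M (fsuc fzero) fzero * D₁) + _)
      ≈⟨ +-congˡ (+-cong (*-congˡ (*-cong (sym (eq fzero)) D₁≈D₀)) (sum-zero (rest M eq))) ⟩
    1# * (M fzero fzero * D₀) + ((- 1# * 1#) * (M fzero fzero * D₀) + 0#)
      ≈⟨ solve 3 (λ e x y → con 1 :* (x :* y) :+ ((e :* con 1) :* (x :* y) :+ con 0) := (con 1 :+ e) :* (x :* y)) refl
           (- 1#) (M fzero fzero) D₀ ⟩
    (1# + - 1#) * (M fzero fzero * D₀) ≈⟨ *-congʳ (-‿inverseʳ 1#) ⟩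
    0# * (M fzero fzero * D₀) ≈⟨ zeroˡ _ ⟩
    0# ∎
    where
    D₀ = det (suc n) (minor fzero fzero M)
    D₁ = det (suc n) (minor (fsuc fzero) fzero M)
    D₁≈D₀ : D₁ ≈ D₀
    D₁≈D₀ = det-cong {M = minor (fsuc fzero) fzero M} {minor fzero fzero M}
      (λ { fzero l → eq (fsuc l) ; (fsuc k) l → refl })
    -- Abstracting over the size again lets the match on `suc n` expose a minor with at least two
    -- rows.
    rest : ∀ {n} (M : Matrix (suc (suc n)) (suc (suc n))) → (∀ j → M fzero j ≈ M (fsuc fzero) j) → (i : Fin n) →
           sign (fsuc (fsuc i)) * (M (fsuc (fsuc i)) fzero * det (suc n) (minor (fsuc (fsuc i)) fzero M)) ≈ 0#
    rest {suc n} M eq i = x*y*0≈0 _ _ (det-alt₀₁ (minor (fsuc (fsuc i)) fzero M) (λ j → eq (fsuc j)))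

  -- Polarisation: the determinant with both rows equal to `s = v + w` is zero, and its expansion
  -- leaves the two mixed terms. The padding with `1#` and `0#` is the shape that `det-linear`
  -- produces at `q = 1#`.
  det-antisym₀₁ : ∀ {n} (v w : Vector Carrier (suc (suc n))) (W : Matrix n (suc (suc n))) →
                  det (suc (suc n)) (v ◂ w ◂ W) + det (suc (suc n)) (w ◂ v ◂ W) ≈ 0#
  det-antisym₀₁ {n} v w W = begin
    D v w + D w v
      ≈⟨ solve 2 (λ x y → x :+ y := con 1 :* (con 1 :* con 0 :+ x) :+ (con 1 :* y :+ con 0)) refl (D v w) (D w v) ⟩
    1# * (1# * 0# + D v w) + (1# * D w v + 0#)
      ≈⟨ +-cong (*-congˡ (+-congʳ (*-congˡ (alt v)))) (+-congˡ (alt w)) ⟨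
    1# * (1# * D v v + D v w) + (1# * D w v + D w w)
      ≈⟨ +-cong (*-congˡ (split₁ v)) (split₁ w) ⟨
    1# * D v s + D w s
      ≈⟨ det-linear fzero {s ◂ s ◂ W} {v ◂ s ◂ W} {w ◂ s ◂ W} 1# (λ j → +-congʳ (sym (*-identityˡ _)))
           (λ { fzero i≢ → contradiction ≡.refl i≢ ; (fsuc i) _ _ → refl })
           (λ { fzero i≢ → contradiction ≡.refl i≢ ; (fsuc i) _ _ → refl }) ⟨
    D s s ≈⟨ alt s ⟩
    0# ∎
    where
    s : Vector Carrier (suc (suc n))
    s j = v j + w j
    D : Vector Carrier (suc (suc n)) → Vector Carrier (suc (suc n)) → Carrier
    D u u′ = det (suc (suc n)) (u ◂ u′ ◂ W)
    alt : ∀ u → D u u ≈ 0#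
    alt u = det-alt₀₁ (u ◂ u ◂ W) (λ _ → refl)
    split₁ : ∀ u → D u s ≈ 1# * D u v + D u w
    split₁ u = det-linear (fsuc fzero) {u ◂ s ◂ W} {u ◂ v ◂ W} {u ◂ w ◂ W} 1# (λ j → +-congʳ (sym (*-identityˡ _)))
      (λ { fzero _ _ → refl ; (fsuc fzero) i≢ → contradiction ≡.refl i≢ ; (fsuc (fsuc i)) _ _ → refl })
      (λ { fzero _ _ → refl ; (fsuc fzero) i≢ → contradiction ≡.refl i≢ ; (fsuc (fsuc i)) _ _ → refl })

  -- Swapping rows 0 and 1 puts the repeated row inside every minor of the first row.
  det-alt₀ : ∀ {n} (k : Fin n) (M : Matrix (suc n) (suc n)) →
             (∀ j → M fzero j ≈ M (fsuc k) j) → det (suc n) M ≈ 0#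
  det-alt₀ fzero M eq = det-alt₀₁ M eq
  det-alt₀ {suc (suc n)} (fsuc k) M eq = begin
    det (suc (suc (suc n))) M
      ≈⟨ det-cong {M = M} {v ◂ w ◂ W} (λ { fzero _ → refl ; (fsuc fzero) _ → refl ; (fsuc (fsuc i)) _ → refl }) ⟩
    det _ (v ◂ w ◂ W) ≈⟨ +-identityʳ _ ⟨
    det _ (v ◂ w ◂ W) + 0# ≈⟨ +-congˡ swapped ⟨
    det _ (v ◂ w ◂ W) + det _ (w ◂ v ◂ W) ≈⟨ det-antisym₀₁ v w W ⟩
    0# ∎
    where
    v = M fzero
    w = M (fsuc fzero)
    W = λ i → M (fsuc (fsuc i))
    swapped : det _ (w ◂ v ◂ W) ≈ 0#
    swapped = trans (det-row (w ◂ v ◂ W))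
      (sum-zero (λ j → x*y*0≈0 (sign j) (w j) (det-alt₀ k (minor fzero j (w ◂ v ◂ W)) (λ l → eq (punchIn j l)))))

  det-alternating : ∀ {n} (i k : Fin n) (M : Matrix n n) → i ≢ k →
                    (∀ j → M i j ≈ M k j) → det n M ≈ 0#
  det-alternating fzero fzero M i≢k eq = contradiction ≡.refl i≢k
  det-alternating fzero (fsuc k) M i≢k eq = det-alt₀ k M eq
  det-alternating (fsuc i) fzero M i≢k eq = det-alt₀ i M (sym ∘ eq)
  det-alternating (fsuc i) (fsuc k) M i≢k eq = trans (det-row M)
    (sum-zero (λ j → x*y*0≈0 (sign j) (M fzero j)
      (det-alternating i k (minor fzero j M) (i≢k ∘ ≡.cong fsuc) (λ l → eq (punchIn j l)))))

  -- The rows are reduced from the bottom up, so that each one still meets its original predecessor: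
  -- induction inside the minors of the first row treats rows 2 and later, and row 1 comes last.
  det-row-reduce : ∀ {n} x (M : Matrix (suc n) (suc n)) (B : Matrix n (suc n)) →
                   (∀ i j → M (fsuc i) j ≈ x * M (inject₁ i) j + B i j) →
                   det (suc n) M ≈ det (suc n) (M fzero ◂ B)
  det-row-reduce {zero} x M B eq = det-cong {M = M} {M fzero ◂ B} (λ { fzero _ → refl })
  det-row-reduce {suc n} x M B eq = begin
    det (suc (suc n)) M ≈⟨ det-row M ⟩
    sum (λ j → sign j * (M fzero j * det (suc n) (minor fzero j M)))
      ≈⟨ sum-cong-≋ (λ j → *-congˡ {sign j} (*-congˡ {M fzero j} (trans
           (det-row-reduce x (minor fzero j M) (λ i l → B (fsuc i) (punchIn j l)) (λ i l → eq (fsuc i) (punchIn j l)))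
           (det-cong {suc n} {minor fzero j M fzero ◂ (λ i l → B (fsuc i) (punchIn j l))} {minor fzero j M′}
             (λ { fzero _ → refl ; (fsuc i) _ → refl }))))) ⟩
    sum (λ j → sign j * (M fzero j * det (suc n) (minor fzero j M′))) ≈⟨ det-row M′ ⟨
    det (suc (suc n)) M′
      ≈⟨ det-linear (fsuc fzero) {M′} {v ◂ v ◂ tail B} {v ◂ B} x (eq fzero)
      (λ { fzero _ _ → refl ; (fsuc fzero) i≢ → contradiction ≡.refl i≢ ; (fsuc (fsuc i)) _ _ → refl })
      (λ { fzero _ _ → refl ; (fsuc fzero) i≢ → contradiction ≡.refl i≢ ; (fsuc (fsuc i)) _ _ → refl }) ⟩
    x * det (suc (suc n)) (v ◂ v ◂ tail B) + det (suc (suc n)) (v ◂ B)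
      ≈⟨ +-congʳ (*-congˡ (det-alt₀₁ (v ◂ v ◂ tail B) (λ _ → refl))) ⟩
    x * 0# + det (suc (suc n)) (v ◂ B) ≈⟨ +-congʳ (zeroʳ x) ⟩
    0# + det (suc (suc n)) (v ◂ B) ≈⟨ +-identityˡ _ ⟩
    det (suc (suc n)) (v ◂ B) ∎
    where
    v = M fzero
    M′ = v ◂ M (fsuc fzero) ◂ tail B

  -- In the expansion along the first row every minor that keeps the last column has a zero column
  -- there. Only the last term survives.
  det-last-col-first : ∀ {n} (N : Matrix (suc n) (suc n)) → (∀ i → N (fsuc i) (fromℕ n) ≈ 0#) →
    det (suc n) N ≈ pow (- 1#) n * (N fzero (fromℕ n) * det n (λ i k → N (fsuc i) (inject₁ k)))
  det-last-col-first {n} N eq = begin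
    det (suc n) N ≈⟨ det-row N ⟩
    sum term ≈⟨ sum-init-last term ⟩
    sum (term ∘ inject₁) + term (fromℕ n) ≈⟨ +-congʳ (sum-zero (vanish N eq)) ⟩
    0# + term (fromℕ n) ≈⟨ +-identityˡ _ ⟩
    term (fromℕ n) ≈⟨ *-cong (reflexive (≡.cong (pow (- 1#)) (toℕ-fromℕ n)))
                        (*-congˡ (det-cong (λ i k → reflexive (≡.cong (N (fsuc i)) (punchIn-fromℕ k))))) ⟩
    _ ∎
    where
    term : Fin (suc n) → Carrier
    term j = sign j * (N fzero j * det n (minor fzero j N))
    vanish : ∀ {n} (N : Matrix (suc n) (suc n)) → (∀ i → N (fsuc i) (fromℕ n) ≈ 0#) → ∀ j →
             sign (inject₁ j) * (N fzero (inject₁ j) * det n (minor fzero (inject₁ j) N)) ≈ 0#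
    vanish {suc n} N eq j = x*y*0≈0 _ _ (trans (det-transpose (minor fzero (inject₁ j) N))
      (det-zero-row (fromℕ n) (minor fzero (inject₁ j) N ᵀ) (λ i →
        trans (reflexive (≡.cong (N (fsuc i)) (punchIn-inject₁-fromℕ j))) (eq i))))

  -- Expanding both sides along the first row matches the signs term by term, so no total sign has
  -- to be computed. The minors again have a last column that is zero above its bottom entry.
  det-last-col-last : ∀ {n} (N : Matrix (suc n) (suc n)) → (∀ i → N (inject₁ i) (fromℕ n) ≈ 0#) →
    det (suc n) N ≈ N (fromℕ n) (fromℕ n) * det n (λ i k → N (inject₁ i) (inject₁ k))
  det-last-col-last {zero} N eq =
    solve 1 (λ x → con 1 :* (x :* con 1) :+ con 0 := x :* con 1) refl (N fzero fzero)
  det-last-col-last {suc n} N eq = begin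
    det (suc (suc n)) N ≈⟨ det-row N ⟩
    sum term ≈⟨ sum-init-last term ⟩
    sum (term ∘ inject₁) + term (fromℕ (suc n)) ≈⟨ +-congˡ (x*0*y≈0 (sign (fromℕ (suc n))) (det (suc n) (minor fzero (fromℕ (suc n)) N)) (eq fzero)) ⟩
    sum (term ∘ inject₁) + 0# ≈⟨ +-identityʳ _ ⟩
    sum (term ∘ inject₁) ≈⟨ sum-cong-≋ step ⟩
    sum (λ j → x * (sign j * (N fzero (inject₁ j) * det n (minor fzero j N′)))) ≈⟨ *-distribˡ-sum {suc n} x (λ j → sign j * (N fzero (inject₁ j) * det n (minor fzero j N′))) ⟨
    x * sum (λ j → sign j * (N fzero (inject₁ j) * det n (minor fzero j N′))) ≈⟨ *-congˡ (det-row N′) ⟨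
    x * det (suc n) N′ ∎
    where
    x = N (fromℕ (suc n)) (fromℕ (suc n))
    N′ : Matrix (suc n) (suc n)
    N′ i k = N (inject₁ i) (inject₁ k)
    term : Fin (suc (suc n)) → Carrier
    term j = sign j * (N fzero j * det (suc n) (minor fzero j N))
    last-col : ∀ j i → minor fzero (inject₁ j) N i (fromℕ n) ≈ N (fsuc i) (fromℕ (suc n))
    last-col j i = reflexive (≡.cong (N (fsuc i)) (punchIn-inject₁-fromℕ j))
    step : ∀ j → term (inject₁ j) ≈ x * (sign j * (N fzero (inject₁ j) * det n (minor fzero j N′)))
    step j = begin
      term (inject₁ j) ≈⟨ *-cong (reflexive (≡.cong (pow (- 1#)) (toℕ-inject₁ j))) (*-congˡ
        (trans (det-last-col-last (minor fzero (inject₁ j) N) (λ i → trans (last-col j (inject₁ i)) (eq (fsuc i))))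
               (*-cong (last-col j (fromℕ n))
                       (det-cong (λ i k → reflexive (≡.cong (N (fsuc (inject₁ i))) (punchIn-inject₁ j k))))))) ⟩
      sign j * (N fzero (inject₁ j) * (x * det n (minor fzero j N′)))
        ≈⟨ solve 4 (λ e a x d → e :* (a :* (x :* d)) := x :* (e :* (a :* d))) refl
             (sign j) (N fzero (inject₁ j)) x (det n (minor fzero j N′)) ⟩
      x * (sign j * (N fzero (inject₁ j) * det n (minor fzero j N′))) ∎

  -- Replacing one row

  setRow : ∀ {m n} → Matrix m n → Fin m → Vector Carrier n → Matrix m n
  setRow M k v = updateAt M k (λ _ → v)

  setRow-updates : ∀ {m n} (M : Matrix m n) k v j → setRow M k v k j ≈ v j
  setRow-updates M k v j = reflexive (≡.cong-app (updateAt-updates k M) j)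

  setRow-minimal : ∀ {m n} (M : Matrix m n) k v {i} j → i ≢ k → setRow M k v i j ≈ M i j
  setRow-minimal M k v {i} j i≢k = reflexive (≡.cong-app (updateAt-minimal i k M i≢k) j)

  -- `Λ (ν i) P` is the combination of the `ν i m` with the coefficients of `P`, so linearity in row
  -- `k` turns the determinants themselves into a moment sequence.
  det-setRow-Λ : ∀ {n} (M : Matrix n n) k (ν : Fin n → ℕ → Carrier) P →
                 det n (setRow M k (λ i → Λ (ν i) P)) ≈ Λ (λ m → det n (setRow M k (λ i → ν i m))) P
  det-setRow-Λ M k ν [] = det-zero-row k _ (setRow-updates M k _)
  det-setRow-Λ {n} M k ν (x ∷ P) = begin
    det n (setRow M k (λ i → x * ν i 0 + Λ (ν i ∘ suc) P))
      ≈⟨ det-linear k {_} {setRow M k (λ i → ν i 0)} {setRow M k (λ i → Λ (ν i ∘ suc) P)} x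
           (λ j → trans (setRow-updates M k _ j)
                        (sym (+-cong (*-congˡ (setRow-updates M k _ j)) (setRow-updates M k _ j))))
           (λ i i≢k j → trans (setRow-minimal M k _ j i≢k) (sym (setRow-minimal M k _ j i≢k)))
           (λ i i≢k j → trans (setRow-minimal M k _ j i≢k) (sym (setRow-minimal M k _ j i≢k))) ⟩
    x * det n (setRow M k (λ i → ν i 0)) + det n (setRow M k (λ i → Λ (ν i ∘ suc) P))
      ≈⟨ +-congˡ (det-setRow-Λ M k (λ i → ν i ∘ suc) P) ⟩
    x * det n (setRow M k (λ i → ν i 0)) + Λ (λ m → det n (setRow M k (λ i → ν i (suc m)))) P ∎

-- Doubling

double : ℕ → ℕ
double zero = zero
double (suc n) = suc (suc (double n))

-- `double` unfolds by two successors at once, as the two-step recursions require; this is the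
-- bridge to the `2 *ℕ n` of `a`, `oddProd` and the theorem.
double≡2* : ∀ n → double n ≡ 2 *ℕ n
double≡2* zero = ≡.refl
double≡2* (suc n) = ≡.cong suc (≡.trans (≡.cong suc (double≡2* n)) (≡.sym (+-suc n (n +ℕ 0))))

double-+ : ∀ m n → double (m +ℕ n) ≡ double m +ℕ double n
double-+ zero n = ≡.refl
double-+ (suc m) n = ≡.cong (suc ∘ suc) (double-+ m n)

double-< : ∀ {m n} → m < n → double m < double n
double-< {zero} {suc n} _ = s≤s z≤n
double-< {suc m} {suc n} (s≤s m<n) = s≤s (s≤s (double-< m<n))

-- Linear functionals given by their moments

module Functional {c ℓ : Level} (R : CommutativeRing c ℓ) (t : ℕ → CommutativeRing.Carrier R) where
  open CommutativeRing R
  open Poly R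
  open Determinant R
  open Algebra.Properties.Ring ring
  open Algebra.Solver.Ring.NaturalCoefficients.Default commutativeSemiring
  open Relation.Binary.Reasoning.Setoid setoid

  Λ-cong : ∀ {ν ν′} P → (∀ k → ν k ≈ ν′ k) → Λ ν P ≈ Λ ν′ P
  Λ-cong [] eq = refl
  Λ-cong (x ∷ P) eq = +-cong (*-congˡ (eq 0)) (Λ-cong P (eq ∘ suc))

  Λ-+ : ∀ {ν ν′} P → Λ (λ k → ν k + ν′ k) P ≈ Λ ν P + Λ ν′ P
  Λ-+ [] = sym (+-identityˡ 0#)
  Λ-+ {ν} {ν′} (x ∷ P) = trans (+-congˡ (Λ-+ P))
    (solve 5 (λ x a b c d → x :* (a :+ b) :+ (c :+ d) := (x :* a :+ c) :+ (x :* b :+ d)) refl x (ν 0) (ν′ 0) _ _)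

  Λ-* : ∀ {ν} y P → Λ (λ k → y * ν k) P ≈ y * Λ ν P
  Λ-* y [] = sym (zeroʳ y)
  Λ-* {ν} y (x ∷ P) = trans (+-congˡ (Λ-* y P))
    (solve 4 (λ y x a b → x :* (y :* a) :+ y :* b := y :* (x :* a :+ b)) refl y x (ν 0) _)

  Λ-addP : ∀ ν P Q → Λ ν (addP P Q) ≈ Λ ν P + Λ ν Q
  Λ-addP ν [] Q = sym (+-identityˡ _)
  Λ-addP ν (x ∷ P) [] = sym (+-identityʳ _)
  Λ-addP ν (x ∷ P) (y ∷ Q) = trans (+-congˡ (Λ-addP (ν ∘ suc) P Q))
    (solve 5 (λ x y a b c → (x :+ y) :* a :+ (b :+ c) := (x :* a :+ b) :+ (y :* a :+ c)) refl x y (ν 0) _ _)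

  Λ-scaleP : ∀ ν y P → Λ ν (scaleP y P) ≈ y * Λ ν P
  Λ-scaleP ν y [] = sym (zeroʳ y)
  Λ-scaleP ν y (x ∷ P) = trans (+-congˡ (Λ-scaleP (ν ∘ suc) y P))
    (solve 4 (λ y x a b → (y :* x) :* a :+ y :* b := y :* (x :* a :+ b)) refl y x (ν 0) _)

  evalP-addP : ∀ P Q x → evalP (addP P Q) x ≈ evalP P x + evalP Q x
  evalP-addP [] Q x = sym (+-identityˡ _)
  evalP-addP (a ∷ P) [] x = sym (+-identityʳ _)
  evalP-addP (a ∷ P) (b ∷ Q) x = trans (+-congˡ (*-congˡ (evalP-addP P Q x)))
    (solve 5 (λ a b x u v → (a :+ b) :+ x :* (u :+ v) := (a :+ x :* u) :+ (b :+ x :* v)) refl a b x _ _)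

  evalP-scaleP : ∀ y P x → evalP (scaleP y P) x ≈ y * evalP P x
  evalP-scaleP y [] x = sym (zeroʳ y)
  evalP-scaleP y (a ∷ P) x = trans (+-congˡ (*-congˡ (evalP-scaleP y P x)))
    (solve 4 (λ y a x u → y :* a :+ x :* (y :* u) := y :* (a :+ x :* u)) refl y a x _)

  evalP-p-rec : ∀ s n x → evalP (p s (suc (suc n))) x ≈ x * evalP (p s (suc n)) x + - s n * evalP (p s n) x
  evalP-p-rec s n x = trans (evalP-addP (shiftP (p s (suc n))) (scaleP (- s n) (p s n)) x) (+-cong (+-identityˡ _) (evalP-scaleP (- s n) (p s n) x))

  -- Kept general in the moments: passing to `ν ∘ suc` stands for multiplication by the variable, so
  -- the recurrence of `p` becomes one between functionals.
  L : (ℕ → Carrier) → ℕ → Carrier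
  L ν n = Λ ν (p t n)

  L-rec : ∀ ν n → L ν (suc (suc n)) ≈ L (ν ∘ suc) (suc n) + - t n * L ν n
  L-rec ν n = trans (Λ-addP ν (shiftP (p t (suc n))) (scaleP (- t n) (p t n)))
    (+-cong (trans (+-congʳ (zeroˡ (ν 0))) (+-identityˡ _)) (Λ-scaleP ν (- t n) (p t n)))

  L-0 : ∀ ν → L ν 0 ≈ ν 0
  L-0 ν = solve 1 (λ x → con 1 :* x :+ con 0 := x) refl (ν 0)

  L-1 : ∀ ν → L ν 1 ≈ ν 1
  L-1 ν = solve 2 (λ x y → con 0 :* x :+ (con 1 :* y :+ con 0) := y) refl (ν 0) (ν 1)

  -- This is monicity of `p t n` in dual form: if all lower moments vanish, only the leading
  -- coefficient `1#` is read off.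
  L-monic : ∀ ν n → (∀ k → k < n → ν k ≈ 0#) → L ν n ≈ ν n
  L-monic ν zero ν≈0 = L-0 ν
  L-monic ν (suc zero) ν≈0 = L-1 ν
  L-monic ν (suc (suc n)) ν≈0 = begin
    L ν (suc (suc n)) ≈⟨ L-rec ν n ⟩
    L (ν ∘ suc) (suc n) + - t n * L ν n
      ≈⟨ +-cong (L-monic (ν ∘ suc) (suc n) (λ k k<n → ν≈0 (suc k) (s≤s k<n)))
                (*-congˡ (trans (L-monic ν n (λ k k<n → ν≈0 k (m<n⇒m<1+n (m<n⇒m<1+n k<n)))) (ν≈0 n (m<n⇒m<1+n (n<1+n n))))) ⟩
    ν (suc (suc n)) + - t n * 0# ≈⟨ +-congˡ (zeroʳ _) ⟩
    ν (suc (suc n)) + 0# ≈⟨ +-identityʳ _ ⟩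
    ν (suc (suc n)) ∎

  -- `p t n` has the parity of `n`, so moments of the other parity meet zero coefficients. The two
  -- cases are mutual because a shift of the moments exchanges parities.
  L-parity-even : ∀ ν ν′ n → (∀ j → ν (double j) ≈ ν′ (double j)) → L ν (double n) ≈ L ν′ (double n)
  L-parity-odd : ∀ ν ν′ n → (∀ j → ν (suc (double j)) ≈ ν′ (suc (double j))) →
                 L ν (suc (double n)) ≈ L ν′ (suc (double n))
  L-parity-even ν ν′ zero eq = trans (L-0 ν) (trans (eq 0) (sym (L-0 ν′)))
  L-parity-even ν ν′ (suc n) eq = trans (L-rec ν (double n)) (trans
    (+-cong (L-parity-odd (ν ∘ suc) (ν′ ∘ suc) n (eq ∘ suc)) (*-congˡ (L-parity-even ν ν′ n eq)))
    (sym (L-rec ν′ (double n))))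
  L-parity-odd ν ν′ zero eq = trans (L-1 ν) (trans (eq 0) (sym (L-1 ν′)))
  L-parity-odd ν ν′ (suc n) eq = trans (L-rec ν (suc (double n))) (trans
    (+-cong (L-parity-even (ν ∘ suc) (ν′ ∘ suc) (suc n) eq) (*-congˡ (L-parity-odd ν ν′ n eq)))
    (sym (L-rec ν′ (suc (double n)))))

  -- The functional y ^ k ↦ Λ_y ((y ^ k - x ^ k) / (y - x)), where Λ_y has the moments μ.
  associated : (ℕ → Carrier) → Carrier → ℕ → Carrier
  associated μ x zero = 0#
  associated μ x (suc k) = x * associated μ x k + μ k

  -- Dual to the substitution `Q ↦ x Q (x ^ 2)`: a functional with moments `s` at `Q` equals the one
  -- with moments `spread s` at the substituted polynomial.
  spread : (ℕ → Carrier) → ℕ → Carrier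
  spread s zero = 0#
  spread s (suc zero) = s 0
  spread s (suc (suc k)) = spread (s ∘ suc) k

  spread-odd : ∀ s n → spread s (suc (double n)) ≡ s n
  spread-odd s zero = ≡.refl
  spread-odd s (suc n) = spread-odd (s ∘ suc) n

  spread-vanish : ∀ s n → (∀ j → j < n → s j ≈ 0#) → ∀ k → k < suc (double n) → spread s k ≈ 0#
  spread-vanish s n s≈0 zero k<n = refl
  spread-vanish s (suc n) s≈0 (suc zero) k<n = s≈0 0 (s≤s z≤n)
  spread-vanish s (suc n) s≈0 (suc (suc k)) (s≤s (s≤s k<n)) =
    spread-vanish (s ∘ suc) n (λ j j<n → s≈0 (suc j) (s≤s j<n)) k k<n
  spread-vanish s zero s≈0 (suc k) (s≤s ())

  -- Writing p t (2 n + 1) = x Q (x ^ 2), K s n is the value at Q of the functional with moments s.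
  K : (ℕ → Carrier) → ℕ → Carrier
  K s n = L (spread s) (suc (double n))

  K-monic : ∀ s n → (∀ j → j < n → s j ≈ 0#) → K s n ≈ s n
  K-monic s n s≈0 = trans (L-monic (spread s) (suc (double n)) (spread-vanish s n s≈0)) (reflexive (spread-odd s n))

  -- The column operation with the coefficients of `Q`

  det-setRow-spread : ∀ {n} (M : Matrix n n) k (s : Fin n → ℕ → Carrier) m →
    det n (setRow M k (λ i → spread (s i) m)) ≈ spread (λ j → det n (setRow M k (λ i → s i j))) m
  det-setRow-spread M k s zero = det-zero-row k _ (setRow-updates M k _)
  det-setRow-spread M k s (suc zero) = refl
  det-setRow-spread M k s (suc (suc m)) = det-setRow-spread M k (λ i → s i ∘ suc) m

  -- Let `κ j` be the determinant with last column `s i j`. For `j < n` a column is repeated, so `κ`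
  -- vanishes below `n` and `K-monic` gives `K κ n ≈ κ n`, the original determinant. The
  -- coefficients of `Q` are never computed. Columns appear as rows of `W` because `setRow` acts on
  -- rows.
  det-setRow-K : ∀ n (s : Fin (suc n) → ℕ → Carrier) →
    det (suc n) (λ i j → s i (toℕ j)) ≈
    det (suc n) (setRow (λ j i → s i (toℕ j)) (fromℕ n) (λ i → K (s i) n) ᵀ)
  det-setRow-K n s = begin
    det (suc n) (W ᵀ) ≈⟨ det-transpose (W ᵀ) ⟩
    det (suc n) W ≈⟨ det-cong {suc n} {setRow W (fromℕ n) (λ i → s i n)} {W} unchanged ⟨
    κ n ≈⟨ K-monic κ n repeated ⟨
    -- Linearity in the replaced row carries the functional inside the determinant, first past
    -- `spread`, then past `Λ`.
    K κ n ≈⟨ Λ-cong (p t (suc (double n))) (det-setRow-spread W (fromℕ n) s) ⟨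
    Λ (λ m → det (suc n) (setRow W (fromℕ n) (λ i → spread (s i) m))) (p t (suc (double n)))
      ≈⟨ det-setRow-Λ W (fromℕ n) (λ i → spread (s i)) (p t (suc (double n))) ⟨
    det (suc n) (setRow W (fromℕ n) (λ i → K (s i) n))
      ≈⟨ det-transpose (setRow W (fromℕ n) (λ i → K (s i) n)) ⟩
    det (suc n) (setRow W (fromℕ n) (λ i → K (s i) n) ᵀ) ∎
    where
    W : Matrix (suc n) (suc n)
    W j i = s i (toℕ j)
    κ : ℕ → Carrier
    κ j = det (suc n) (setRow W (fromℕ n) (λ i → s i j))
    unchanged : setRow W (fromℕ n) (λ i → s i n) ≋ W
    unchanged j i = reflexive (≡.cong-app
      (updateAt-id-local (fromℕ n) W (≡.cong (λ m i → s i m) (≡.sym (toℕ-fromℕ n))) j) i)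
    repeated : ∀ j → j < n → κ j ≈ 0#
    repeated j j<n = det-alternating (fromℕ n) k (setRow W (fromℕ n) _) fromℕ≢inject₁ λ i → begin
      setRow W (fromℕ n) (λ i → s i j) (fromℕ n) i ≈⟨ setRow-updates W (fromℕ n) _ i ⟩
      s i j ≡⟨ ≡.cong (s i) (≡.trans (toℕ-inject₁ (fromℕ< j<n)) (toℕ-fromℕ< j<n)) ⟨
      s i (toℕ k) ≈⟨ setRow-minimal W (fromℕ n) _ i (fromℕ≢inject₁ ∘ ≡.sym) ⟨
      setRow W (fromℕ n) (λ i → s i j) k i ∎
      where
      k = inject₁ (fromℕ< j<n)

  setRow-inject₁ : ∀ n (s : Fin (suc n) → ℕ → Carrier) v i k →
    setRow (λ j i → s i (toℕ j)) (fromℕ n) v (inject₁ k) i ≈ s i (toℕ k)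
  setRow-inject₁ n s v i k = trans (setRow-minimal {suc n} (λ j i → s i (toℕ j)) (fromℕ n) v i (fromℕ≢inject₁ ∘ ≡.sym))
    (reflexive (≡.cong (s i) (toℕ-inject₁ k)))

  -- Serves the matrix of `d`, where orthogonality kills the new column outside the first row;
  -- `det-K-last` serves the Hankel matrix, where only the last row survives.
  det-K-first : ∀ n (s : Fin (suc n) → ℕ → Carrier) → (∀ i → K (s (fsuc i)) n ≈ 0#) →
    det (suc n) (λ i j → s i (toℕ j)) ≈
    pow (- 1#) n * (K (s fzero) n * det n (λ i j → s (fsuc i) (toℕ j)))
  det-K-first n s K≈0 = begin
    det (suc n) (λ i j → s i (toℕ j)) ≈⟨ det-setRow-K n s ⟩
    det (suc n) (N ᵀ) ≈⟨ det-last-col-first (N ᵀ) (λ i → trans (setRow-updates _ (fromℕ n) _ (fsuc i)) (K≈0 i)) ⟩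
    pow (- 1#) n * (N (fromℕ n) fzero * det n (λ i k → N (inject₁ k) (fsuc i)))
      ≈⟨ *-congˡ (*-cong (setRow-updates _ (fromℕ n) _ fzero) (det-cong (λ i k → setRow-inject₁ n s _ (fsuc i) k))) ⟩
    _ ∎
    where
    N = setRow {suc n} (λ j i → s i (toℕ j)) (fromℕ n) (λ i → K (s i) n)

  det-K-last : ∀ n (s : Fin (suc n) → ℕ → Carrier) → (∀ i → K (s (inject₁ i)) n ≈ 0#) →
    det (suc n) (λ i j → s i (toℕ j)) ≈ K (s (fromℕ n)) n * det n (λ i j → s (inject₁ i) (toℕ j))
  det-K-last n s K≈0 = begin
    det (suc n) (λ i j → s i (toℕ j)) ≈⟨ det-setRow-K n s ⟩
    det (suc n) (N ᵀ) ≈⟨ det-last-col-last (N ᵀ) (λ i → trans (setRow-updates _ (fromℕ n) _ (inject₁ i)) (K≈0 i)) ⟩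
    N (fromℕ n) (fromℕ n) * det n (λ i k → N (inject₁ k) (inject₁ i))
      ≈⟨ *-cong (setRow-updates _ (fromℕ n) _ (fromℕ n)) (det-cong (λ i k → setRow-inject₁ n s _ (inject₁ i) k)) ⟩
    _ ∎
    where
    N = setRow {suc n} (λ j i → s i (toℕ j)) (fromℕ n) (λ i → K (s i) n)

  -- Products of the `t n`, values at zero, and the sums `r`

  prefixProd : ℕ → Carrier
  prefixProd zero = 1#
  prefixProd (suc n) = t n * prefixProd n

  T : ℕ → Carrier
  T k = t (suc k)

  -- At zero the recurrence loses its first term, so each double step contributes the factor
  -- `- T (2 n) = - t (2 n + 1)`.
  evalP-p-zero : ∀ n → evalP (p T (double n)) 0# ≈ pow (- 1#) n * oddProd t n
  evalP-p-zero zero = solve 0 (con 1 :+ con 0 :* con 0 := con 1 :* con 1) refl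
  evalP-p-zero (suc n) = begin
    evalP (p T (double (suc n))) 0# ≈⟨ evalP-p-rec T (double n) 0# ⟩
    0# * _ + - t (suc (double n)) * evalP (p T (double n)) 0#
      ≈⟨ +-cong (zeroˡ _) (*-cong (trans (-‿cong (reflexive (≡.cong T (double≡2* n)))) (sym (-1*x≈-x _))) (evalP-p-zero n)) ⟩
    0# + (- 1# * t (suc (2 *ℕ n))) * (pow (- 1#) n * oddProd t n)
      ≈⟨ solve 4 (λ e u v w → con 0 :+ (e :* u) :* (v :* w) := (e :* v) :* (w :* u)) refl (- 1#) _ _ _ ⟩
    pow (- 1#) (suc n) * oddProd t (suc n) ∎

  pow-cong : ∀ {x y} n → x ≈ y → pow x n ≈ pow y n
  pow-cong zero eq = refl
  pow-cong (suc n) eq = *-cong eq (pow-cong n eq)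

  sumTo-cong : ∀ {f g} n → (∀ k → f k ≈ g k) → sumTo n f ≈ sumTo n g
  sumTo-cong zero eq = eq 0
  sumTo-cong (suc n) eq = +-cong (sumTo-cong n eq) (eq (suc n))

  sumTo-head : ∀ n f → sumTo (suc n) f ≈ f 0 + sumTo n (f ∘ suc)
  sumTo-head zero f = refl
  sumTo-head (suc n) f = trans (+-congʳ (sumTo-head n f)) (+-assoc _ _ _)

  sumTo-*ˡ : ∀ n x f → sumTo n (λ k → x * f k) ≈ x * sumTo n f
  sumTo-*ˡ zero x f = refl
  sumTo-*ˡ (suc n) x f = trans (+-congʳ (sumTo-*ˡ n x f)) (sym (distribˡ x _ _))

  d-cong : ∀ μ n {x y} → x ≈ y → d μ n x ≈ d μ n y
  d-cong μ n eq = det-cong {suc n} (λ i j →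
    sumTo-cong (toℕ i +ℕ toℕ j) (λ k → *-congˡ {a μ (toℕ i +ℕ toℕ j ∸ℕ k)} (pow-cong k eq)))

  r-suc : ∀ μ n x → r μ (suc n) x ≈ x * r μ n x + a μ (suc n)
  r-suc μ n x = begin
    -- The term `k = 0` is split off; in the others `suc n ∸ suc k` reduces to `n ∸ k`, and one
    -- factor `x` comes out.
    r μ (suc n) x ≈⟨ sumTo-head n _ ⟩
    a μ (suc n) * 1# + sumTo n (λ k → a μ (n ∸ℕ k) * (x * pow x k))
      ≈⟨ +-cong (*-identityʳ _) (sumTo-cong n (λ k → x∙yz≈y∙xz (a μ (n ∸ℕ k)) x (pow x k))) ⟩
    a μ (suc n) + sumTo n (λ k → x * (a μ (n ∸ℕ k) * pow x k)) ≈⟨ +-congˡ (sumTo-*ˡ n x _) ⟩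
    a μ (suc n) + x * r μ n x ≈⟨ +-comm _ _ ⟩
    x * r μ n x + a μ (suc n) ∎
    where open Algebra.Properties.CommutativeSemigroup *-commutativeSemigroup using (x∙yz≈y∙xz)

  -- Orthogonality and vanishing odd moments

  module _ (μ : ℕ → Carrier) (Λp : ∀ n → Λ μ (p t n) ≈ δ n) where

    -- The value Λ (x ^ m p_n(x, t)).
    N : ℕ → ℕ → Carrier
    N m n = L (λ k → μ (m +ℕ k)) n

    L-shift : ∀ m n → L (λ k → μ (m +ℕ suc k)) n ≈ N (suc m) n
    L-shift m n = Λ-cong (p t n) (λ k → reflexive (≡.cong μ (+-suc m k)))

    N-suc-zero : ∀ m → N (suc m) 0 ≈ N m 1
    N-suc-zero m = trans (L-0 (λ k → μ (suc m +ℕ k)))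
      (trans (reflexive (≡.cong μ (≡.sym (+-suc m 0)))) (sym (L-1 (λ k → μ (m +ℕ k)))))

    -- The recurrence solved for the product with the variable: `x p_{n+1} = p_{n+2} + t_n p_n`.
    N-suc-suc : ∀ m n → N (suc m) (suc n) ≈ N m (suc (suc n)) + t n * N m n
    N-suc-suc m n = begin
      N (suc m) (suc n) ≈⟨ +-identityʳ _ ⟨
      N (suc m) (suc n) + 0# ≈⟨ +-congˡ (-‿inverseˡ _) ⟨
      N (suc m) (suc n) + (- (t n * N m n) + t n * N m n) ≈⟨ +-assoc _ _ _ ⟨
      (N (suc m) (suc n) + - (t n * N m n)) + t n * N m n
        ≈⟨ +-congʳ (+-cong (sym (L-shift m (suc n))) (-‿distribˡ-* _ _)) ⟩
      (L (λ k → μ (m +ℕ suc k)) (suc n) + - t n * N m n) + t n * N m n ≈⟨ +-congʳ (L-rec _ n) ⟨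
      N m (suc (suc n)) + t n * N m n ∎

    x+y*z≈0 : ∀ {x} y {z} → x ≈ 0# → z ≈ 0# → x + y * z ≈ 0#
    x+y*z≈0 y x≈0 z≈0 = trans (+-cong x≈0 (trans (*-congˡ z≈0) (zeroʳ y))) (+-identityˡ 0#)

    N-orthogonal : ∀ m n → m < n → N m n ≈ 0#
    N-orthogonal zero (suc n) m<n = Λp (suc n)
    N-orthogonal (suc m) (suc n) (s≤s m<n) = trans (N-suc-suc m n)
      (x+y*z≈0 (t n) (N-orthogonal m (suc (suc n)) (m<n⇒m<1+n (m<n⇒m<1+n m<n))) (N-orthogonal m n m<n))

    -- This is the norm `Λ (p_n ^ 2)`; in `N-suc-suc` the higher term vanishes by orthogonality, and
    -- each step leaves one factor `t n`.
    N-diagonal : ∀ n → N n n ≈ prefixProd n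
    N-diagonal zero = Λp 0
    N-diagonal (suc n) = trans (N-suc-suc n n) (trans
      (+-cong (N-orthogonal n (suc (suc n)) (m<n⇒m<1+n (n<1+n n))) (*-congˡ (N-diagonal n)))
      (+-identityˡ _))

    -- Each step lowers `m` by one and moves `n` by one, so `m + n` stays odd. At `m = 0` the index
    -- `n` is odd, hence positive, and `Λ` kills `p t n`.
    N-parity : ∀ m n q → m +ℕ n ≡ suc (double q) → N m n ≈ 0#
    N-parity zero (suc n) q eq = Λp (suc n)
    N-parity (suc m) zero q eq = trans (N-suc-zero m) (N-parity m 1 q (≡.trans (+-suc m 0) eq))
    N-parity (suc m) (suc n) q eq = trans (N-suc-suc m n)
      (x+y*z≈0 (t n) (N-parity m (suc (suc n)) q (≡.trans (+-suc m (suc n)) eq))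
                     (lower q (≡.trans (≡.sym (+-suc m n)) (ℕ-suc-injective eq))))
      where
      lower : ∀ q → suc (m +ℕ n) ≡ double q → N m n ≈ 0#
      lower (suc q) eq = N-parity m n q (ℕ-suc-injective eq)

    μ-odd : ∀ n → μ (suc (double n)) ≈ 0#
    μ-odd n = begin
      μ (suc (double n)) ≡⟨ ≡.cong (μ ∘ suc) (+-identityʳ-ℕ (double n)) ⟨
      μ (suc (double n +ℕ 0)) ≈⟨ L-0 (λ k → μ (suc (double n +ℕ k))) ⟨
      N (suc (double n)) 0 ≈⟨ N-parity (suc (double n)) 0 n (+-identityʳ-ℕ _) ⟩
      0# ∎

    -- Values of `K` on the rows of the determinants

    a-double : ∀ n → a μ n ≡ μ (double n)
    a-double n = ≡.cong μ (≡.sym (double≡2* n))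

    -- `a (i + j + 1)` is the moment at exponent `(2 i + 1) + (2 j + 1)`. Only the odd exponents
    -- `2 j + 1` need comparison, since `p t (2 n + 1)` is odd.
    K-a : ∀ i n → K (λ j → a μ (suc (i +ℕ j))) n ≈ N (suc (double i)) (suc (double n))
    K-a i n = L-parity-odd _ _ n (λ j → reflexive (≡.trans (spread-odd _ j) (≡.trans (a-double (suc (i +ℕ j)))
      (≡.cong (μ ∘ suc) (≡.trans (≡.cong suc (double-+ i j)) (≡.sym (+-suc (double i) (double j))))))))

    -- The difference quotient of `y ^ (2 j + 1)` is the sum of the `x ^ k y ^ (2 j - k)`. Odd
    -- powers of `y` have zero moment; the even ones give `a (j - i) x ^ (2 i)`.
    associated-odd : ∀ x j → associated μ x (suc (double j)) ≈ r μ j (x * x)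
    associated-odd x zero = solve 2 (λ x y → x :* con 0 :+ y := y :* con 1) refl x (μ 0)
    associated-odd x (suc j) = begin
      x * (x * associated μ x (suc (double j)) + μ (suc (double j))) + μ (double (suc j))
        ≈⟨ +-cong (*-congˡ (+-cong (*-congˡ (associated-odd x j)) (μ-odd j))) (reflexive (≡.sym (a-double (suc j)))) ⟩
      x * (x * r μ j (x * x) + 0#) + a μ (suc j)
        ≈⟨ solve 3 (λ x y z → x :* (x :* y :+ con 0) :+ z := (x :* x) :* y :+ z) refl x _ _ ⟩
      (x * x) * r μ j (x * x) + a μ (suc j) ≈⟨ r-suc μ j (x * x) ⟨
      r μ (suc j) (x * x) ∎

    -- Shifting `associated μ x` multiplies it by `x` and adds `μ`; the added part contributes
    -- `Λ μ (p t (suc n))`, which is zero.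
    L-associated-rec : ∀ x n → L (associated μ x) (suc (suc n)) ≈ x * L (associated μ x) (suc n) + - t n * L (associated μ x) n
    L-associated-rec x n = begin
      L h (suc (suc n)) ≈⟨ L-rec h n ⟩
      L (λ k → x * h k + μ k) (suc n) + - t n * L h n ≈⟨ +-congʳ (Λ-+ (p t (suc n))) ⟩
      (Λ (λ k → x * h k) (p t (suc n)) + L μ (suc n)) + - t n * L h n
        ≈⟨ +-congʳ (+-cong (Λ-* x (p t (suc n))) (Λp (suc n))) ⟩
      (x * L h (suc n) + 0#) + - t n * L h n ≈⟨ +-congʳ (+-identityʳ _) ⟩
      x * L h (suc n) + - t n * L h n ∎
      where h = associated μ x

    L-associated-1 : ∀ x → L (associated μ x) 1 ≈ 1#
    L-associated-1 x = begin
      L (associated μ x) 1 ≈⟨ L-1 (associated μ x) ⟩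
      x * 0# + μ 0 ≈⟨ +-cong (zeroʳ x) (sym (L-0 μ)) ⟩
      0# + L μ 0 ≈⟨ +-identityˡ _ ⟩
      L μ 0 ≈⟨ Λp 0 ⟩
      1# ∎

    -- These are the associated polynomials of `p t`. They take the values 0 and 1 at indices 0 and
    -- 1, so counted from index 1 they obey the recurrence with coefficients `t 1, t 2, …`, which is
    -- that of `p T`.
    L-associated : ∀ x n → L (associated μ x) (suc n) ≈ evalP (p T n) x
    L-associated x zero = trans (L-associated-1 x) (solve 1 (λ x → con 1 := con 1 :+ x :* con 0) refl x)
    L-associated x (suc zero) = begin
      L (associated μ x) 2 ≈⟨ L-associated-rec x 0 ⟩
      -- `t 0` drops out because it multiplies the value at index 0, which is zero.
      x * L (associated μ x) 1 + - t 0 * L (associated μ x) 0 ≈⟨ +-cong (*-congˡ (L-associated-1 x)) (*-congˡ (L-0 (associated μ x))) ⟩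
      x * 1# + - t 0 * 0#
        ≈⟨ solve 2 (λ x y → x :* con 1 :+ y :* con 0 := con 0 :+ x :* (con 1 :+ x :* con 0)) refl x (- t 0) ⟩
      evalP (p T 1) x ∎
    L-associated x (suc (suc n)) = trans (L-associated-rec x (suc n)) (trans
      (+-cong (*-congˡ (L-associated x (suc n))) (*-congˡ (L-associated x n)))
      (sym (evalP-p-rec T n x)))

    K-r : ∀ x n → K (λ j → r μ j (x * x)) n ≈ evalP (p T (double n)) x
    K-r x n = trans
      (L-parity-odd _ (associated μ x) n (λ j → trans (reflexive (spread-odd _ j)) (sym (associated-odd x j))))
      (L-associated x (double n))

    -- Evaluation of the Hankel determinants

    shiftedHankel : ℕ → Carrier
    shiftedHankel n = det n (λ i j → a μ (suc (toℕ i +ℕ toℕ j)))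

    -- The new last column has the entries `N (2 i + 1) (2 n + 1)`: zero for `i < n`, and the
    -- diagonal value `t 0 ⋯ t (2 n)` for `i = n`.
    shiftedHankel-suc : ∀ n → shiftedHankel (suc n) ≈ prefixProd (suc (double n)) * shiftedHankel n
    shiftedHankel-suc n = begin
      shiftedHankel (suc n) ≈⟨ det-K-last n (λ i j → a μ (suc (toℕ i +ℕ j)))
        (λ i → trans (K-a (toℕ (inject₁ i)) n) (N-orthogonal _ _ (s≤s (double-< (inject₁ℕ< i))))) ⟩
      K (λ j → a μ (suc (toℕ (fromℕ n) +ℕ j))) n * det n (λ i j → a μ (suc (toℕ (inject₁ i) +ℕ toℕ j)))
        ≈⟨ *-cong (trans (K-a (toℕ (fromℕ n)) n) (trans
             (reflexive (≡.cong (λ m → N (suc (double m)) (suc (double n))) (toℕ-fromℕ n))) (N-diagonal (suc (double n)))))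
             (det-cong {n} (λ i j → reflexive (≡.cong (λ m → a μ (suc (m +ℕ toℕ j))) (toℕ-inject₁ i)))) ⟩
      prefixProd (suc (double n)) * shiftedHankel n ∎

    d-formula : ∀ n x → d μ n (x * x) ≈ pow (- 1#) n * (evalP (p T (double n)) x * shiftedHankel n)
    d-formula n x = begin
      d μ n (x * x)
        ≈⟨ det-row-reduce {n} (x * x) (λ i j → r μ (toℕ i +ℕ toℕ j) (x * x)) B
             (λ i j → trans (r-suc μ (toℕ i +ℕ toℕ j) (x * x))
               (+-congʳ (*-congˡ (reflexive (≡.cong (λ m → r μ (m +ℕ toℕ j) (x * x)) (≡.sym (toℕ-inject₁ i))))))) ⟩
      det (suc n) ((λ j → r μ (toℕ j) (x * x)) ◂ B) ≈⟨ det-cong {suc n} {_ ◂ B} {λ i j → s i (toℕ j)} (λ { fzero j → refl ; (fsuc i) j → refl }) ⟩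
      det (suc n) (λ i j → s i (toℕ j))
        -- Row `i + 1` holds `a (i + 1 + j)`, so its new last entry is `N (2 i + 1) (2 n + 1)` with
        -- `i < n`; the block left over is `shiftedHankel n`.
        ≈⟨ det-K-first n s (λ i → trans (K-a (toℕ i) n) (N-orthogonal _ _ (s≤s (double-< (toℕ<n i))))) ⟩
      pow (- 1#) n * (K (s fzero) n * shiftedHankel n) ≈⟨ *-congˡ (*-congʳ (K-r x n)) ⟩
      pow (- 1#) n * (evalP (p T (double n)) x * shiftedHankel n) ∎
      where
      B : Matrix n (suc n)
      B i j = a μ (suc (toℕ i +ℕ toℕ j))
      s : Fin (suc n) → ℕ → Carrier
      s fzero j = r μ j (x * x)
      s (fsuc i) j = a μ (suc (toℕ i +ℕ j))

    sign² : ∀ n → pow (- 1#) n * pow (- 1#) n ≈ 1#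
    sign² zero = *-identityˡ 1#
    sign² (suc n) = begin
      (- 1# * pow (- 1#) n) * (- 1# * pow (- 1#) n)
        ≈⟨ solve 2 (λ e x → (e :* x) :* (e :* x) := (e :* e) :* (x :* x)) refl (- 1#) _ ⟩
      (- 1# * - 1#) * (pow (- 1#) n * pow (- 1#) n) ≈⟨ *-cong (trans (-1*x≈-x _) (-‿involutive 1#)) (sign² n) ⟩
      1# * 1# ≈⟨ *-identityˡ 1# ⟩
      1# ∎

    -- `d-formula` at `x = 0`: its sign cancels against the one in `evalP-p-zero`.
    d-zero : ∀ n → d μ n 0# ≈ oddProd t n * shiftedHankel n
    d-zero n = begin
      d μ n 0# ≈⟨ d-cong μ n (zeroˡ 0#) ⟨
      d μ n (0# * 0#) ≈⟨ d-formula n 0# ⟩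
      pow (- 1#) n * (evalP (p T (double n)) 0# * shiftedHankel n) ≈⟨ *-congˡ (*-congʳ (evalP-p-zero n)) ⟩
      pow (- 1#) n * ((pow (- 1#) n * oddProd t n) * shiftedHankel n)
        ≈⟨ solve 3 (λ e u v → e :* ((e :* u) :* v) := (e :* e) :* (u :* v)) refl _ _ _ ⟩
      (pow (- 1#) n * pow (- 1#) n) * (oddProd t n * shiftedHankel n) ≈⟨ *-congʳ (sign² n) ⟩
      1# * (oddProd t n * shiftedHankel n) ≈⟨ *-identityˡ _ ⟩
      oddProd t n * shiftedHankel n ∎

    -- The quotient identity with denominators cleared; `d-nonzero` and `oddProd-nonzero` justify
    -- dividing.
    d-ratio : ∀ n x → d μ n (x * x) * oddProd t n ≈ (pow (- 1#) n * d μ n 0#) * evalP (p T (2 *ℕ n)) x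
    d-ratio n x = begin
      d μ n (x * x) * oddProd t n ≈⟨ *-congʳ (d-formula n x) ⟩
      (pow (- 1#) n * (evalP (p T (double n)) x * shiftedHankel n)) * oddProd t n
        ≈⟨ solve 4 (λ e u v w → (e :* (u :* v)) :* w := (e :* (w :* v)) :* u) refl _ _ _ _ ⟩
      (pow (- 1#) n * (oddProd t n * shiftedHankel n)) * evalP (p T (double n)) x
        ≈⟨ *-cong (*-congˡ (sym (d-zero n))) (reflexive (≡.cong (λ m → evalP (p T m) x) (double≡2* n))) ⟩
      (pow (- 1#) n * d μ n 0#) * evalP (p T (2 *ℕ n)) x ∎

    -- Nonvanishing over a field

    module _ (isField : IsField R) (t≉0 : ∀ n → ¬ (t n ≈ 0#)) where
      open IsField isField

      1≉0 : ¬ (1# ≈ 0#)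
      1≉0 = 0≉1 ∘ sym

      *-nonzero : ∀ {x y} → ¬ (x ≈ 0#) → ¬ (y ≈ 0#) → ¬ (x * y ≈ 0#)
      *-nonzero {x} {y} x≉0 y≉0 xy≈0 with inverse x x≉0
      ... | z , xz≈1 = y≉0 (begin
        y ≈⟨ *-identityˡ y ⟨
        1# * y ≈⟨ *-congʳ xz≈1 ⟨
        (x * z) * y ≈⟨ solve 3 (λ x y z → (x :* z) :* y := z :* (x :* y)) refl x y z ⟩
        z * (x * y) ≈⟨ *-congˡ xy≈0 ⟩
        z * 0# ≈⟨ zeroʳ z ⟩
        0# ∎)

      prefixProd-nonzero : ∀ n → ¬ (prefixProd n ≈ 0#)
      prefixProd-nonzero zero = 1≉0
      prefixProd-nonzero (suc n) = *-nonzero (t≉0 n) (prefixProd-nonzero n)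

      oddProd-nonzero : ∀ n → ¬ (oddProd t n ≈ 0#)
      oddProd-nonzero zero = 1≉0
      oddProd-nonzero (suc n) = *-nonzero (oddProd-nonzero n) (t≉0 _)

      shiftedHankel-nonzero : ∀ n → ¬ (shiftedHankel n ≈ 0#)
      shiftedHankel-nonzero zero = 1≉0
      shiftedHankel-nonzero (suc n) eq =
        *-nonzero (prefixProd-nonzero (suc (double n))) (shiftedHankel-nonzero n) (trans (sym (shiftedHankel-suc n)) eq)

      d-nonzero : ∀ n → ¬ (d μ n 0# ≈ 0#)
      d-nonzero n d≈0 = *-nonzero (oddProd-nonzero n) (shiftedHankel-nonzero n) (trans (sym (d-zero n)) d≈0)

theorem1 : {c ℓ : Level} (F : CommutativeRing c ℓ) → IsField F →
    let open CommutativeRing F in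
    let open Poly F in
    (t : ℕ → Carrier) → (∀ n → ¬ (t n ≈ 0#)) →
    (μ : ℕ → Carrier) → (∀ n → Λ μ (p t n) ≈ δ n) →
    (n : ℕ) → (x : Carrier) →
    ¬ (d μ n 0# ≈ 0#)
    × (d μ n (x * x) * oddProd t n
    ≈ (pow (- 1#) n * d μ n 0#) * evalP (p (λ k → t (suc k)) (2 Data.Nat.* n)) x)
theorem1 F isField t t≉0 μ Λp n x = d-nonzero μ Λp isField t≉0 n , d-ratio μ Λp n x
  where open Functional F t
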